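{- Let $F_{3,3}$ be the $3$-graph on vertex set $\{1,\dots,6\}$ with $3$-edges $123, 145, 146, 156, 245, 246, 256, 345, 346, 356$. For every positive integer $n$, $$3\left\lfloor\frac n5\right\rfloor\le \mathrm{co^+ex}(n,F_{3,3})\le \frac34 n .$$
   Context: A $3$-graph is a finite $3$-uniform hypergraph; an edge is written as the concatenation of its vertices. The minimum positive co-degree $\delta_2^+(H)$ of a non-empty $3$-graph $H$ is the maximum $k$ such that every pair of vertices contained in some edge of $H$ is contained in at least $k$ distinct edges of $H$; by convention it is $0$ if $H$ has no edges. A hypergraph is $F$-free if it has no (not necessarily induced) subhypergraph isomorphic to $F$. $\mathrm{co^+ex}(n,F)$ is the maximum of $\delta_2^+(H)$ over all $n$-vertex $F$-free $3$-graphs $H$. -}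

module Defs where

open import Level using (0ℓ; Level)
open import Data.Bool.Properties using () renaming (_≟_ to _≟ᵇ_)
open import Data.Nat using (ℕ; _≤_)
open import Data.Nat.Properties using () renaming (_≟_ to _≟ⁿ_)
open import Data.Fin using (Fin; #_)
open import Data.Fin.Subset using (Subset; ∣_∣; _∈_; _∪_; ⁅_⁆)
open import Data.List using (List; []; _∷_)
open import Data.List.Relation.Unary.All using (all?; lookup)
open import Data.Product using (_×_; ∃; ∃-syntax)
open import Data.Sum using (_⊎_)
open import Data.Vec.Properties using (≡-dec)
open import Function.Definitions using (Injective)
open import Relation.Binary.PropositionalEquality using (_≡_; _≢_)
open import Relation.Nullary using (¬_)
open import Relation.Nullary.Decidable using (toWitness)
open import Relation.Unary using (Pred; Decidable)
import Data.List.Membership.DecPropositional as DecMembership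

-- Decidability of the edge predicate is what makes the edges a finite set.
record 3-Graph (n : ℕ) : Set₁ where
  field
    IsEdge  : Pred (Subset n) 0ℓ
    isEdge? : Decidable IsEdge
    uniform : ∀ e → IsEdge e → ∣ e ∣ ≡ 3

open 3-Graph public

⁅_,_,_⁆ : ∀ {n} → Fin n → Fin n → Fin n → Subset n
⁅ u , v , w ⁆ = ⁅ u ⁆ ∪ ⁅ v ⁆ ∪ ⁅ w ⁆

-- When u, v, w are not distinct, ⁅ u , v , w ⁆ has fewer than three elements
-- and so is never an edge; hence quantifying over all u, v, w is harmless.
Contains : ∀ {n p} → 3-Graph n → 3-Graph p → Set
Contains {n} {p} H F =
  ∃[ f ] Injective {A = Fin p} {B = Fin n} _≡_ _≡_ f ×
    (∀ u v w → IsEdge F ⁅ u , v , w ⁆ → IsEdge H ⁅ f u , f v , f w ⁆)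

_IsFreeOf_ : ∀ {n p} → 3-Graph n → 3-Graph p → Set
H IsFreeOf F = ¬ Contains H F

EdgeThrough : ∀ {n} → 3-Graph n → Fin n → Fin n → Pred (Subset n) 0ℓ
EdgeThrough H u v e = IsEdge H e × u ∈ e × v ∈ e

CodegreeAtLeast : ∀ {n} → 3-Graph n → Fin n → Fin n → ℕ → Set
CodegreeAtLeast {n} H u v k =
  ∃[ es ] Injective {A = Fin k} {B = Subset n} _≡_ _≡_ es ×
    (∀ i → EdgeThrough H u v (es i))

PositiveCodegreesAtLeast : ∀ {n} → 3-Graph n → ℕ → Set
PositiveCodegreesAtLeast H k =
  ∀ u v → u ≢ v → ∃ (EdgeThrough H u v) → CodegreeAtLeast H u v k

IsMaximum : {ℓ : Level} → Pred ℕ ℓ → ℕ → Set ℓ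
IsMaximum P m = P m × (∀ k → P k → k ≤ m)

-- IsMinPositiveCodegree H d says that δ₂⁺(H) = d.
IsMinPositiveCodegree : ∀ {n} → 3-Graph n → ℕ → Set
IsMinPositiveCodegree H d =
    (¬ ∃ (IsEdge H) × d ≡ 0)
  ⊎ (∃ (IsEdge H) × IsMaximum (PositiveCodegreesAtLeast H) d)

-- IsCo⁺ex n F m says that co⁺ex(n, F) exists and equals m.
IsCo⁺ex : ∀ {p} → ℕ → 3-Graph p → ℕ → Set₁
IsCo⁺ex n F = IsMaximum λ d →
  ∃[ H ] H IsFreeOf F × IsMinPositiveCodegree {n} H d

-- The vertices 1, …, 6 are represented by # 0, …, # 5.
F₃,₃-edges : List (Subset 6)
F₃,₃-edges =
    ⁅ # 0 , # 1 , # 2 ⁆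
  ∷ ⁅ # 0 , # 3 , # 4 ⁆ ∷ ⁅ # 0 , # 3 , # 5 ⁆ ∷ ⁅ # 0 , # 4 , # 5 ⁆
  ∷ ⁅ # 1 , # 3 , # 4 ⁆ ∷ ⁅ # 1 , # 3 , # 5 ⁆ ∷ ⁅ # 1 , # 4 , # 5 ⁆
  ∷ ⁅ # 2 , # 3 , # 4 ⁆ ∷ ⁅ # 2 , # 3 , # 5 ⁆ ∷ ⁅ # 2 , # 4 , # 5 ⁆
  ∷ []

F₃,₃ : 3-Graph 6
F₃,₃ = record
  { IsEdge  = _∈ˡ F₃,₃-edges
  ; isEdge? = _∈ˡ? F₃,₃-edges
  ; uniform = λ _ → lookup (toWitness {a? = all? (λ e → ∣ e ∣ ≟ⁿ 3) F₃,₃-edges} _)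
  }
  where
  open DecMembership (≡-dec {n = 6} _≟ᵇ_) using () renaming (_∈_ to _∈ˡ_; _∈?_ to _∈ˡ?_)

{-# OPTIONS --safe #-}
module Submission where

-- Upper bound: suppose 4k > 3n, where k is the minimum positive co-degree of H,
-- and let abd be an edge. The common neighbourhood S of the pairs ab, ad, bd has
-- at least 3k − 2n > n − k vertices, so S meets the neighbourhood of every
-- covered pair. Pick x ∈ S, then y ∈ S with xay an edge, then z ∈ S with xyz an
-- edge: now {x, y, z} and {a, b, d} span a copy of F₃,₃.
--
-- Lower bound: colour the vertices by their residues mod 5 and take all triples
-- with three distinct colours. Every covered pair has at least 3⌊n/5⌋ extensions,
-- and since all pairs of vertices of F₃,₃ are covered, a copy of F₃,₃ would need
-- six colours.
--
-- The maximum exists constructively because the 3-graphs on n vertices can be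
-- searched exhaustively.

open import Defs
open import Level using (Level; 0ℓ)
open import Data.Bool using (Bool; true; false; T; T?)
open import Data.Bool.Properties using () renaming (_≟_ to _≟ᵇ_)
open import Data.Empty using () renaming (⊥ to Empty)
open import Data.Nat using (ℕ; zero; suc; NonZero; _+_; _*_; _≤_; _<_; z≤n; s≤s; s≤s⁻¹; z<s)
open import Data.Nat.DivMod using (_/_; _%_; _mod_; m/n*n≤m; [m+kn]%n≡m%n; m<n⇒m%n≡m)
open import Data.Nat.Properties as ℕₚ using (_≤?_; ≰⇒>; module ≤-Reasoning)
open import Data.Nat.Tactic.RingSolver using (solve-∀)
open import Data.Fin using (Fin; zero; suc; #_; toℕ; _≟_; punchIn; punchOut; combine; remQuot; inject≤)
open import Data.Fin.Properties as Fin using (all?; any?; pigeonhole)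
open import Data.Fin.Subset using (Subset; ∣_∣; _∈_; _∉_; _∪_; _∩_; _-_; ⊥; Nonempty; inside; outside)
  renaming (⁅_⁆ to ｛_｝) -- ⁅ u , v , w ⁆ would otherwise also parse as the singleton of a tuple
open import Data.Fin.Subset.Properties
open import Data.List.Relation.Unary.All as All using (All; []; _∷_)
open import Data.List.Relation.Unary.Any using (here)
open import Data.Product using (_×_; _,_; ∃; ∃-syntax; proj₁; proj₂; map₂)
open import Data.Sum using (_⊎_; inj₁; inj₂; [_,_]′)
open import Data.Unit using (tt)
open import Data.Vec using (Vec; []; _∷_; lookup; tabulate; here; there)
open import Data.Vec.Properties using (≡-dec; lookup∘tabulate; lookup⇒[]=; []=⇒lookup)
open import Function using (_∘_)
open import Function.Definitions using (Injective)
open import Relation.Binary.PropositionalEquality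
  using (_≡_; _≢_; _≗_; refl; sym; trans; cong; cong₂; subst; ≢-sym; module ≡-Reasoning)
open import Relation.Nullary using (¬_; Dec; yes; no; does; proof; contradiction)
open import Relation.Nullary.Decidable
  using (map′; ¬?; _×-dec_; _→-dec_; _⊎-dec_; toWitness; fromWitness; ⌊_⌋; dec-true)
open import Relation.Nullary.Reflects using (Reflects; invert)
open import Relation.Unary using (Pred; Decidable)

private
  variable
    ℓ : Level
    A : Set
    k n p : ℕ

-- Finite subsets

∣p∪q∣+∣p∩q∣≡∣p∣+∣q∣ : (p q : Subset n) → ∣ p ∪ q ∣ + ∣ p ∩ q ∣ ≡ ∣ p ∣ + ∣ q ∣
∣p∪q∣+∣p∩q∣≡∣p∣+∣q∣ [] [] = refl
∣p∪q∣+∣p∩q∣≡∣p∣+∣q∣ (inside ∷ p) (inside ∷ q) = cong suc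
  (trans (ℕₚ.+-suc _ _) (trans (cong suc (∣p∪q∣+∣p∩q∣≡∣p∣+∣q∣ p q)) (sym (ℕₚ.+-suc _ _))))
∣p∪q∣+∣p∩q∣≡∣p∣+∣q∣ (inside ∷ p) (outside ∷ q) = cong suc (∣p∪q∣+∣p∩q∣≡∣p∣+∣q∣ p q)
∣p∪q∣+∣p∩q∣≡∣p∣+∣q∣ (outside ∷ p) (inside ∷ q) =
  trans (cong suc (∣p∪q∣+∣p∩q∣≡∣p∣+∣q∣ p q)) (sym (ℕₚ.+-suc _ _))
∣p∪q∣+∣p∩q∣≡∣p∣+∣q∣ (outside ∷ p) (outside ∷ q) = ∣p∪q∣+∣p∩q∣≡∣p∣+∣q∣ p q

∣p∣+∣q∣≤n+∣p∩q∣ : (p q : Subset n) → ∣ p ∣ + ∣ q ∣ ≤ n + ∣ p ∩ q ∣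
∣p∣+∣q∣≤n+∣p∩q∣ {n} p q = subst (_≤ n + ∣ p ∩ q ∣) (∣p∪q∣+∣p∩q∣≡∣p∣+∣q∣ p q)
  (ℕₚ.+-monoˡ-≤ ∣ p ∩ q ∣ (∣p∣≤n (p ∪ q)))

∣p∪q∣≤∣p∣+∣q∣ : (p q : Subset n) → ∣ p ∪ q ∣ ≤ ∣ p ∣ + ∣ q ∣
∣p∪q∣≤∣p∣+∣q∣ p q = subst (∣ p ∪ q ∣ ≤_) (∣p∪q∣+∣p∩q∣≡∣p∣+∣q∣ p q) (ℕₚ.m≤m+n _ _)

0<∣p∣⇒Nonempty : (p : Subset n) → 0 < ∣ p ∣ → Nonempty p
0<∣p∣⇒Nonempty {n} p 0<∣p∣ with nonempty? p
... | yes ne = ne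
... | no ¬ne = contradiction (trans (cong ∣_∣ (Empty-unique ¬ne)) (∣⊥∣≡0 n)) (≢-sym (ℕₚ.<⇒≢ 0<∣p∣))

∣p∣≡0⇒p≡⊥ : {p : Subset n} → ∣ p ∣ ≡ 0 → p ≡ ⊥
∣p∣≡0⇒p≡⊥ {p = []} _ = refl
∣p∣≡0⇒p≡⊥ {p = outside ∷ p} eq = cong (outside ∷_) (∣p∣≡0⇒p≡⊥ eq)

n<∣p∣+∣q∣⇒p∩q-Nonempty : (p q : Subset n) → n < ∣ p ∣ + ∣ q ∣ → Nonempty (p ∩ q)
n<∣p∣+∣q∣⇒p∩q-Nonempty {n} p q n< = 0<∣p∣⇒Nonempty (p ∩ q) (ℕₚ.+-cancelˡ-< n _ _
  (subst (_< n + ∣ p ∩ q ∣) (sym (ℕₚ.+-identityʳ n)) (ℕₚ.<-≤-trans n< (∣p∣+∣q∣≤n+∣p∩q∣ p q))))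

x∉p-x : (x : Fin n) (p : Subset n) → x ∉ p - x
x∉p-x zero (_ ∷ _) ()
x∉p-x (suc x) (_ ∷ p) (there x∈) = x∉p-x x p x∈

x∈p⇒∣p∣≡1+∣p-x∣ : {x : Fin n} {p : Subset n} → x ∈ p → ∣ p ∣ ≡ suc ∣ p - x ∣
x∈p⇒∣p∣≡1+∣p-x∣ {p = _ ∷ p} here = cong (suc ∘ ∣_∣) (sym (p─⊥≡p p))
x∈p⇒∣p∣≡1+∣p-x∣ {p = inside ∷ p} (there x∈p) = cong suc (x∈p⇒∣p∣≡1+∣p-x∣ x∈p)
x∈p⇒∣p∣≡1+∣p-x∣ {p = outside ∷ p} (there x∈p) = x∈p⇒∣p∣≡1+∣p-x∣ x∈p

x∈p⇒p≡⁅x⁆∪p-x : {x : Fin n} {p : Subset n} → x ∈ p → p ≡ ｛ x ｝ ∪ (p - x)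
x∈p⇒p≡⁅x⁆∪p-x {p = _ ∷ p} here =
  cong (inside ∷_) (sym (trans (∪-identityˡ _) (p─⊥≡p p)))
x∈p⇒p≡⁅x⁆∪p-x {p = s ∷ p} (there x∈p) = cong (s ∷_) (x∈p⇒p≡⁅x⁆∪p-x x∈p)

-- Induction on `k`: by injectivity the values other than `g zero` all survive its removal from `p`.
injection⇒≤∣p∣ : {p : Subset n} (g : Fin k → Fin n) → Injective _≡_ _≡_ g → (∀ i → g i ∈ p) → k ≤ ∣ p ∣
injection⇒≤∣p∣ {k = zero} _ _ _ = z≤n
injection⇒≤∣p∣ {k = suc k} g inj g∈ = subst (suc k ≤_) (sym (x∈p⇒∣p∣≡1+∣p-x∣ (g∈ zero)))
  (s≤s (injection⇒≤∣p∣ (g ∘ suc) (Fin.suc-injective ∘ inj)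
    λ i → x∈p∧x≢y⇒x∈p-y (g∈ (suc i)) (λ eq → Fin.0≢1+n (sym (inj eq)))))

-- Triples

∈-triple₁ : (u v w : Fin n) → u ∈ ⁅ u , v , w ⁆
∈-triple₁ u v w = x∈p∪q⁺ (inj₁ (x∈⁅x⁆ u))

∈-triple₂ : (u v w : Fin n) → v ∈ ⁅ u , v , w ⁆
∈-triple₂ u v w = x∈p∪q⁺ (inj₂ (x∈p∪q⁺ (inj₁ (x∈⁅x⁆ v))))

∈-triple₃ : (u v w : Fin n) → w ∈ ⁅ u , v , w ⁆
∈-triple₃ u v w = x∈p∪q⁺ (inj₂ (x∈p∪q⁺ (inj₂ (x∈⁅x⁆ w))))

∈-triple⁻ : {x : Fin n} (u v w : Fin n) → x ∈ ⁅ u , v , w ⁆ → x ≡ u ⊎ x ≡ v ⊎ x ≡ w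
∈-triple⁻ u v w x∈ with x∈p∪q⁻ ｛ u ｝ _ x∈
... | inj₁ x∈u = inj₁ (x∈⁅y⁆⇒x≡y u x∈u)
... | inj₂ x∈vw with x∈p∪q⁻ ｛ v ｝ _ x∈vw
...   | inj₁ x∈v = inj₂ (inj₁ (x∈⁅y⁆⇒x≡y v x∈v))
...   | inj₂ x∈w = inj₂ (inj₂ (x∈⁅y⁆⇒x≡y w x∈w))

triple-rotate : (u v w : Fin n) → ⁅ u , v , w ⁆ ≡ ⁅ w , u , v ⁆
triple-rotate u v w = trans (sym (∪-assoc ｛ u ｝ ｛ v ｝ ｛ w ｝)) (∪-comm (｛ u ｝ ∪ ｛ v ｝) ｛ w ｝)

-- A repeated entry leaves a union of two singletons, of size at most 2. Other pairs of entries are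
-- reached through `triple-rotate`.
∣triple∣≡3⇒≢ : (u v w : Fin n) → ∣ ⁅ u , v , w ⁆ ∣ ≡ 3 → u ≢ v
∣triple∣≡3⇒≢ u .u w eq refl = ℕₚ.<-irrefl refl (begin-strict
  2                       <⟨ ℕₚ.≤-reflexive (sym eq) ⟩
  ∣ ⁅ u , u , w ⁆ ∣       ≡⟨ cong ∣_∣ (sym (∪-assoc ｛ u ｝ ｛ u ｝ ｛ w ｝)) ⟩
  ∣ (｛ u ｝ ∪ ｛ u ｝) ∪ ｛ w ｝ ∣ ≡⟨ cong (λ p → ∣ p ∪ ｛ w ｝ ∣) (∪-idem ｛ u ｝) ⟩
  ∣ ｛ u ｝ ∪ ｛ w ｝ ∣       ≤⟨ ∣p∪q∣≤∣p∣+∣q∣ ｛ u ｝ ｛ w ｝ ⟩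
  ∣ ｛ u ｝ ∣ + ∣ ｛ w ｝ ∣   ≡⟨ cong₂ _+_ (∣⁅x⁆∣≡1 u) (∣⁅x⁆∣≡1 w) ⟩
  2                       ∎)
  where open ≤-Reasoning

x∉p⇒∣⁅x⁆∪p∣≡1+∣p∣ : {x : Fin n} {p : Subset n} → x ∉ p → ∣ ｛ x ｝ ∪ p ∣ ≡ suc ∣ p ∣
x∉p⇒∣⁅x⁆∪p∣≡1+∣p∣ {n} {x} {p} x∉p = begin
  ∣ ｛ x ｝ ∪ p ∣                   ≡⟨ sym (ℕₚ.+-identityʳ _) ⟩
  ∣ ｛ x ｝ ∪ p ∣ + 0               ≡⟨ cong (∣ ｛ x ｝ ∪ p ∣ +_) (sym ∣∩∣≡0) ⟩
  ∣ ｛ x ｝ ∪ p ∣ + ∣ ｛ x ｝ ∩ p ∣   ≡⟨ ∣p∪q∣+∣p∩q∣≡∣p∣+∣q∣ ｛ x ｝ p ⟩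
  ∣ ｛ x ｝ ∣ + ∣ p ∣               ≡⟨ cong (_+ ∣ p ∣) (∣⁅x⁆∣≡1 x) ⟩
  suc ∣ p ∣                       ∎
  where
  open ≡-Reasoning
  ∣∩∣≡0 : ∣ ｛ x ｝ ∩ p ∣ ≡ 0
  ∣∩∣≡0 = trans (cong ∣_∣ (Empty-unique λ (y , y∈) → let y∈x , y∈p = x∈p∩q⁻ ｛ x ｝ p y∈ in
    x∉p (subst (_∈ p) (x∈⁅y⁆⇒x≡y x y∈x) y∈p))) (∣⊥∣≡0 n)

distinct⇒∣triple∣≡3 : {u v w : Fin n} → u ≢ v → u ≢ w → v ≢ w → ∣ ⁅ u , v , w ⁆ ∣ ≡ 3
distinct⇒∣triple∣≡3 {u = u} {v} {w} u≢v u≢w v≢w = trans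
  (x∉p⇒∣⁅x⁆∪p∣≡1+∣p∣ u∉)
  (cong suc (trans (x∉p⇒∣⁅x⁆∪p∣≡1+∣p∣ (x≢y⇒x∉⁅y⁆ v≢w)) (cong suc (∣⁅x⁆∣≡1 w))))
  where
  u∉ : u ∉ ｛ v ｝ ∪ ｛ w ｝
  u∉ u∈ with x∈p∪q⁻ ｛ v ｝ _ u∈
  ... | inj₁ u∈v = u≢v (x∈⁅y⁆⇒x≡y v u∈v)
  ... | inj₂ u∈w = u≢w (x∈⁅y⁆⇒x≡y w u∈w)

-- Removing `u` and `v` leaves exactly one element. It is put first to match the triples in `link`.
third : {e : Subset n} {u v : Fin n} → ∣ e ∣ ≡ 3 → u ∈ e → v ∈ e → u ≢ v → ∃[ w ] e ≡ ⁅ w , u , v ⁆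
third {e = e} {u} {v} ∣e∣≡3 u∈e v∈e u≢v = w , trans e≡ (triple-rotate u v w)
  where
  v∈e-u : v ∈ e - u
  v∈e-u = x∈p∧x≢y⇒x∈p-y v∈e (≢-sym u≢v)
  ∣e-u∣≡2 : ∣ e - u ∣ ≡ 2
  ∣e-u∣≡2 = ℕₚ.suc-injective (trans (sym (x∈p⇒∣p∣≡1+∣p-x∣ u∈e)) ∣e∣≡3)
  ∣e-u-v∣≡1 : ∣ e - u - v ∣ ≡ 1
  ∣e-u-v∣≡1 = ℕₚ.suc-injective (trans (sym (x∈p⇒∣p∣≡1+∣p-x∣ v∈e-u)) ∣e-u∣≡2)
  rest : Nonempty (e - u - v)
  rest = 0<∣p∣⇒Nonempty _ (subst (0 <_) (sym ∣e-u-v∣≡1) z<s)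
  w = proj₁ rest
  ∣e-u-v-w∣≡0 : ∣ e - u - v - w ∣ ≡ 0
  ∣e-u-v-w∣≡0 = ℕₚ.suc-injective (trans (sym (x∈p⇒∣p∣≡1+∣p-x∣ (proj₂ rest))) ∣e-u-v∣≡1)
  open ≡-Reasoning
  e≡ : e ≡ ⁅ u , v , w ⁆
  e≡ = begin
    e                                       ≡⟨ x∈p⇒p≡⁅x⁆∪p-x u∈e ⟩
    ｛ u ｝ ∪ (e - u)                         ≡⟨ cong (｛ u ｝ ∪_) (x∈p⇒p≡⁅x⁆∪p-x v∈e-u) ⟩
    ｛ u ｝ ∪ ｛ v ｝ ∪ (e - u - v)             ≡⟨ cong (λ p → ｛ u ｝ ∪ ｛ v ｝ ∪ p) (x∈p⇒p≡⁅x⁆∪p-x (proj₂ rest)) ⟩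
    ｛ u ｝ ∪ ｛ v ｝ ∪ ｛ w ｝ ∪ (e - u - v - w) ≡⟨ cong (λ p → ｛ u ｝ ∪ ｛ v ｝ ∪ ｛ w ｝ ∪ p) (∣p∣≡0⇒p≡⊥ ∣e-u-v-w∣≡0) ⟩
    ｛ u ｝ ∪ ｛ v ｝ ∪ ｛ w ｝ ∪ ⊥               ≡⟨ cong (λ p → ｛ u ｝ ∪ ｛ v ｝ ∪ p) (∪-identityʳ ｛ w ｝) ⟩
    ⁅ u , v , w ⁆                           ∎

∣e∣≡3⇒triple : {e : Subset n} → ∣ e ∣ ≡ 3 → ∃[ u ] ∃[ v ] ∃[ w ] e ≡ ⁅ u , v , w ⁆
∣e∣≡3⇒triple {e = e} ∣e∣≡3 = let w , e≡ = third ∣e∣≡3 u∈e v∈e u≢v in w , _ , _ , e≡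
  where
  first : Nonempty e
  first = 0<∣p∣⇒Nonempty e (subst (0 <_) (sym ∣e∣≡3) z<s)
  u∈e = proj₂ first
  second : Nonempty (e - proj₁ first)
  second = 0<∣p∣⇒Nonempty _ (s≤s⁻¹ (subst (1 <_) (trans (sym ∣e∣≡3) (x∈p⇒∣p∣≡1+∣p-x∣ u∈e)) (s≤s z<s)))
  v∈e = p─q⊆p e ｛ proj₁ first ｝ (proj₂ second)
  u≢v : proj₁ first ≢ proj₁ second
  u≢v u≡v = x∉p-x _ e (subst (_∈ e - proj₁ first) (sym u≡v) (proj₂ second))

-- F₃,₃

-- Abstract, since unfolding the decision procedure on open terms is prohibitively slow.
abstract
  F₃,₃-covers-pairs : ∀ i j → i ≢ j → ∃[ w ] IsEdge F₃,₃ ⁅ i , j , w ⁆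
  F₃,₃-covers-pairs = toWitness
    {a? = all? λ i → all? λ j → ¬? (i ≟ j) →-dec any? λ w → isEdge? F₃,₃ ⁅ i , j , w ⁆} tt

-- Edges are sets, so a triple may list a known edge in another order. The map `f` is arbitrary
-- because the injectivity of the embedding into `H` is itself deduced from the edges.
triple-map : (f : Fin p → Fin n) (u v w u′ v′ w′ : Fin p) →
  ⁅ u , v , w ⁆ ≡ ⁅ u′ , v′ , w′ ⁆ → ⁅ f u , f v , f w ⁆ ≡ ⁅ f u′ , f v′ , f w′ ⁆
triple-map f u v w u′ v′ w′ eq =
  ⊆-antisym (image-⊆ u v w u′ v′ w′ eq) (image-⊆ u′ v′ w′ u v w (sym eq))
  where
  f∈ : ∀ x u v w → x ∈ ⁅ u , v , w ⁆ → f x ∈ ⁅ f u , f v , f w ⁆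
  f∈ x u v w x∈ with ∈-triple⁻ u v w x∈
  ... | inj₁ refl        = ∈-triple₁ (f x) _ _
  ... | inj₂ (inj₁ refl) = ∈-triple₂ _ (f x) _
  ... | inj₂ (inj₂ refl) = ∈-triple₃ _ _ (f x)
  image-⊆ : ∀ u v w u′ v′ w′ → ⁅ u , v , w ⁆ ≡ ⁅ u′ , v′ , w′ ⁆ →
    ∀ {y} → y ∈ ⁅ f u , f v , f w ⁆ → y ∈ ⁅ f u′ , f v′ , f w′ ⁆
  image-⊆ u v w u′ v′ w′ eq y∈ with ∈-triple⁻ (f u) (f v) (f w) y∈
  ... | inj₁ refl        = f∈ u u′ v′ w′ (subst (u ∈_) eq (∈-triple₁ u v w))
  ... | inj₂ (inj₁ refl) = f∈ v u′ v′ w′ (subst (v ∈_) eq (∈-triple₂ u v w))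
  ... | inj₂ (inj₂ refl) = f∈ w u′ v′ w′ (subst (w ∈_) eq (∈-triple₃ u v w))

edge⇒≢ : (H : 3-Graph n) {u v w : Fin n} → IsEdge H ⁅ u , v , w ⁆ → u ≢ v
edge⇒≢ H = ∣triple∣≡3⇒≢ _ _ _ ∘ uniform H _

-- In `F₃,₃` this is how each of the vertices 1, 2, 3 is related to 4, 5, 6.
JoinedTo : 3-Graph n → (a b d x : Fin n) → Set
JoinedTo H a b d x = IsEdge H ⁅ x , a , b ⁆ × IsEdge H ⁅ x , a , d ⁆ × IsEdge H ⁅ x , b , d ⁆

-- The vertices 1, 2, 3 go to `x`, `y`, `z` and 4, 5, 6 go to `a`, `b`, `d`.
contains-F₃,₃ : (H : 3-Graph n) {x y z a b d : Fin n} → IsEdge H ⁅ x , y , z ⁆ →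
  JoinedTo H a b d x → JoinedTo H a b d y → JoinedTo H a b d z → Contains H F₃,₃
contains-F₃,₃ {n} H {x} {y} {z} {a} {b} {d} xyz (xab , xad , xbd) (yab , yad , ybd) (zab , zad , zbd) =
  f , f-injective , f-edge
  where
  f : Fin 6 → Fin n
  f = lookup (x ∷ y ∷ z ∷ a ∷ b ∷ d ∷ [])
  MapsToEdge : Subset 6 → Set
  MapsToEdge e = ∀ u v w → ⁅ u , v , w ⁆ ≡ e → IsEdge H ⁅ f u , f v , f w ⁆
  maps-to : ∀ u′ v′ w′ → IsEdge H ⁅ f u′ , f v′ , f w′ ⁆ → MapsToEdge ⁅ u′ , v′ , w′ ⁆
  maps-to u′ v′ w′ edge u v w eq = subst (IsEdge H) (sym (triple-map f u v w u′ v′ w′ eq)) edge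
  edges-map : All MapsToEdge F₃,₃-edges
  edges-map =
      maps-to (# 0) (# 1) (# 2) xyz
    ∷ maps-to (# 0) (# 3) (# 4) xab ∷ maps-to (# 0) (# 3) (# 5) xad ∷ maps-to (# 0) (# 4) (# 5) xbd
    ∷ maps-to (# 1) (# 3) (# 4) yab ∷ maps-to (# 1) (# 3) (# 5) yad ∷ maps-to (# 1) (# 4) (# 5) ybd
    ∷ maps-to (# 2) (# 3) (# 4) zab ∷ maps-to (# 2) (# 3) (# 5) zad ∷ maps-to (# 2) (# 4) (# 5) zbd
    ∷ []
  f-edge : ∀ u v w → IsEdge F₃,₃ ⁅ u , v , w ⁆ → IsEdge H ⁅ f u , f v , f w ⁆
  f-edge u v w uvw = All.lookup edges-map uvw u v w refl
  -- Distinctness of the six images comes for free: any two vertices of `F₃,₃` share an edge, and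
  -- its image, being an edge of `H`, has three distinct vertices.
  f-injective : Injective _≡_ _≡_ f
  f-injective {i} {j} fi≡fj with i ≟ j
  ... | yes i≡j = i≡j
  ... | no i≢j = let w , ijw = F₃,₃-covers-pairs i j i≢j in
    contradiction fi≡fj (edge⇒≢ H (f-edge i j w ijw))

-- The upper bound

link : 3-Graph n → Fin n → Fin n → Subset n
link H u v = tabulate λ w → does (isEdge? H ⁅ w , u , v ⁆)

∈-link⁺ : (H : 3-Graph n) (w u v : Fin n) → IsEdge H ⁅ w , u , v ⁆ → w ∈ link H u v
∈-link⁺ H w u v wuv = lookup⇒[]= w _ (trans (lookup∘tabulate _ w) (dec-true (isEdge? H _) wuv))

∈-link⁻ : (H : 3-Graph n) (w u v : Fin n) → w ∈ link H u v → IsEdge H ⁅ w , u , v ⁆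
∈-link⁻ H w u v w∈ = invert (subst (Reflects _)
  (trans (sym (lookup∘tabulate _ w)) ([]=⇒lookup w∈)) (proof (isEdge? H ⁅ w , u , v ⁆)))

-- Each edge through `u` and `v` is determined by its third vertex, so distinct edges give distinct
-- elements of the link.
codegree≤∣link∣ : (H : 3-Graph n) (u v : Fin n) → u ≢ v → CodegreeAtLeast H u v k → k ≤ ∣ link H u v ∣
codegree≤∣link∣ {n} {k} H u v u≢v (es , es-injective , es-through) =
  injection⇒≤∣p∣ g g-injective g∈
  where
  completion : ∀ i → ∃[ w ] es i ≡ ⁅ w , u , v ⁆
  completion i = let e , u∈ , v∈ = es-through i in third (uniform H _ e) u∈ v∈ u≢v
  g : Fin k → Fin n
  g = proj₁ ∘ completion
  g-injective : Injective _≡_ _≡_ g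
  g-injective {i} {j} gi≡gj = es-injective (trans (proj₂ (completion i))
    (trans (cong (λ w → ⁅ w , u , v ⁆) gi≡gj) (sym (proj₂ (completion j)))))
  g∈ : ∀ i → g i ∈ link H u v
  g∈ i = ∈-link⁺ H _ u v (subst (IsEdge H) (proj₂ (completion i)) (proj₁ (es-through i)))

-- Inclusion-exclusion, applied twice, bounds the triple intersection below by 3k - 2n. Adding
-- `n + n` to both sides avoids truncated subtraction.
common-neighbourhood-bound : (p q r : Subset n) →
  k ≤ ∣ p ∣ → k ≤ ∣ q ∣ → k ≤ ∣ r ∣ → 3 * n < 4 * k → n < ∣ p ∩ q ∩ r ∣ + k
common-neighbourhood-bound {n} {k} p q r k≤p k≤q k≤r 3n<4k =
  ℕₚ.+-cancelˡ-< (n + n) _ _ (begin-strict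
  (n + n) + n                        ≡⟨ triple n ⟩
  3 * n                              <⟨ 3n<4k ⟩
  4 * k                              ≡⟨ quadruple k ⟩
  (k + (k + k)) + k                  ≤⟨ ℕₚ.+-monoˡ-≤ k (ℕₚ.+-mono-≤ k≤p (ℕₚ.+-mono-≤ k≤q k≤r)) ⟩
  (∣ p ∣ + (∣ q ∣ + ∣ r ∣)) + k      ≤⟨ ℕₚ.+-monoˡ-≤ k (ℕₚ.+-monoʳ-≤ (∣ p ∣) (∣p∣+∣q∣≤n+∣p∩q∣ q r)) ⟩
  (∣ p ∣ + (n + ∣ q ∩ r ∣)) + k      ≡⟨ shuffle₁ (∣ p ∣) n (∣ q ∩ r ∣) k ⟩
  n + (∣ p ∣ + ∣ q ∩ r ∣) + k        ≤⟨ ℕₚ.+-monoˡ-≤ k (ℕₚ.+-monoʳ-≤ n (∣p∣+∣q∣≤n+∣p∩q∣ p (q ∩ r))) ⟩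
  n + (n + ∣ p ∩ q ∩ r ∣) + k        ≡⟨ shuffle₂ n (∣ p ∩ q ∩ r ∣) k ⟩
  (n + n) + (∣ p ∩ q ∩ r ∣ + k)      ∎)
  where
  open ≤-Reasoning
  triple : ∀ a → (a + a) + a ≡ 3 * a
  triple = solve-∀
  quadruple : ∀ a → 4 * a ≡ (a + (a + a)) + a
  quadruple = solve-∀
  shuffle₁ : ∀ a b c d → (a + (b + c)) + d ≡ b + (a + c) + d
  shuffle₁ = solve-∀
  shuffle₂ : ∀ a b c → a + (a + b) + c ≡ (a + a) + (b + c)
  shuffle₂ = solve-∀

codegree-upper-bound : (H : 3-Graph n) → H IsFreeOf F₃,₃ → ∃ (IsEdge H) →
  PositiveCodegreesAtLeast H k → 4 * k ≤ 3 * n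
codegree-upper-bound {n} {k} H free (e , e-edge) codegrees with 4 * k ≤? 3 * n
... | yes 4k≤3n = 4k≤3n
... | no 4k≰3n with ∣e∣≡3⇒triple {e = e} (uniform H e e-edge)
...   | a , b , d , refl = contradiction
  (contains-F₃,₃ H zxy (S-joined z∈S) (S-joined x∈S) (S-joined y∈S)) free
  where
  k≤∣link∣ : ∀ u v {e} → IsEdge H e → u ∈ e → v ∈ e → u ≢ v → k ≤ ∣ link H u v ∣
  k≤∣link∣ u v e u∈ v∈ u≢v = codegree≤∣link∣ H u v u≢v (codegrees u v u≢v (_ , e , u∈ , v∈))
  a∈ = ∈-triple₁ a b d
  b∈ = ∈-triple₂ a b d
  d∈ = ∈-triple₃ a b d
  a≢b : a ≢ b
  a≢b = edge⇒≢ H e-edge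
  d≢a : d ≢ a
  d≢a = edge⇒≢ H (subst (IsEdge H) (triple-rotate a b d) e-edge)
  b≢d : b ≢ d
  b≢d = edge⇒≢ H (subst (IsEdge H) (trans (triple-rotate a b d) (triple-rotate d a b)) e-edge)
  k≤ab = k≤∣link∣ a b e-edge a∈ b∈ a≢b
  S : Subset n
  S = link H a b ∩ link H a d ∩ link H b d
  S-joined : ∀ {x} → x ∈ S → JoinedTo H a b d x
  S-joined x∈S =
    let x∈ab , x∈rest = x∈p∩q⁻ (link H a b) _ x∈S
        x∈ad , x∈bd   = x∈p∩q⁻ (link H a d) _ x∈rest
    in ∈-link⁻ H _ a b x∈ab , ∈-link⁻ H _ a d x∈ad , ∈-link⁻ H _ b d x∈bd
  S-meets : ∀ q → k ≤ ∣ q ∣ → ∃[ x ] x ∈ S × x ∈ q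
  S-meets q k≤∣q∣ = map₂ (x∈p∩q⁻ S q) (n<∣p∣+∣q∣⇒p∩q-Nonempty S q (ℕₚ.<-≤-trans
    (common-neighbourhood-bound (link H a b) (link H a d) (link H b d) k≤ab
      (k≤∣link∣ a d e-edge a∈ d∈ (≢-sym d≢a)) (k≤∣link∣ b d e-edge b∈ d∈ b≢d) (≰⇒> 4k≰3n))
    (ℕₚ.+-monoʳ-≤ (∣ S ∣) k≤∣q∣)))
  -- Only `x ∈ S` is wanted; `link H a b` serves as a set of size at least `k`.
  x-found = S-meets (link H a b) k≤ab
  x = proj₁ x-found
  x∈S = proj₁ (proj₂ x-found)
  xab = proj₁ (S-joined x∈S)
  y-found = S-meets (link H x a) (k≤∣link∣ x a xab (∈-triple₁ x a b) (∈-triple₂ x a b) (edge⇒≢ H xab))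
  y = proj₁ y-found
  y∈S = proj₁ (proj₂ y-found)
  yxa : IsEdge H ⁅ y , x , a ⁆
  yxa = ∈-link⁻ H y x a (proj₂ (proj₂ y-found))
  -- The edge `yxa` was sought in order to make `xy` a covered pair, so that its link is large.
  z-found = S-meets (link H x y)
    (k≤∣link∣ x y yxa (∈-triple₂ y x a) (∈-triple₁ y x a) (≢-sym (edge⇒≢ H yxa)))
  z∈S = proj₁ (proj₂ z-found)
  zxy = ∈-link⁻ H _ x y (proj₂ (proj₂ z-found))

-- The lower bound

-- The complete 5-partite 3-graph whose parts are the colour classes, some possibly empty.
rainbow : (Fin n → Fin 5) → 3-Graph n
rainbow c = record
  { IsEdge  = λ e → ∣ e ∣ ≡ 3 × (∀ x y → x ∈ e → y ∈ e → c x ≡ c y → x ≡ y)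
  ; isEdge? = λ e → (∣ e ∣ ℕₚ.≟ 3) ×-dec
      (all? λ x → all? λ y → x ∈? e →-dec (y ∈? e →-dec (c x ≟ c y →-dec x ≟ y)))
  ; uniform = λ _ → proj₁
  }

rainbow-triple : (c : Fin n → Fin 5) {u v w : Fin n} →
  c u ≢ c v → c u ≢ c w → c v ≢ c w → IsEdge (rainbow c) ⁅ u , v , w ⁆
rainbow-triple c {u} {v} {w} cu≢cv cu≢cw cv≢cw =
  distinct⇒∣triple∣≡3 (cu≢cv ∘ cong c) (cu≢cw ∘ cong c) (cv≢cw ∘ cong c) , injective
  where
  injective : ∀ x y → x ∈ ⁅ u , v , w ⁆ → y ∈ ⁅ u , v , w ⁆ → c x ≡ c y → x ≡ y
  injective x y x∈ y∈ eq with ∈-triple⁻ u v w x∈ | ∈-triple⁻ u v w y∈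
  ... | inj₁ refl        | inj₁ refl        = refl
  ... | inj₁ refl        | inj₂ (inj₁ refl) = contradiction eq cu≢cv
  ... | inj₁ refl        | inj₂ (inj₂ refl) = contradiction eq cu≢cw
  ... | inj₂ (inj₁ refl) | inj₁ refl        = contradiction (sym eq) cu≢cv
  ... | inj₂ (inj₁ refl) | inj₂ (inj₁ refl) = refl
  ... | inj₂ (inj₁ refl) | inj₂ (inj₂ refl) = contradiction eq cv≢cw
  ... | inj₂ (inj₂ refl) | inj₁ refl        = contradiction (sym eq) cu≢cw
  ... | inj₂ (inj₂ refl) | inj₂ (inj₁ refl) = contradiction (sym eq) cv≢cw
  ... | inj₂ (inj₂ refl) | inj₂ (inj₂ refl) = refl

rainbow-free : (c : Fin n → Fin 5) → rainbow c IsFreeOf F₃,₃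
rainbow-free c (f , f-injective , f-edge) =
  let i , j , i<j , eq = pigeonhole (ℕₚ.n<1+n 5) (c ∘ f)
      i≢j = Fin.<⇒≢ i<j
      w , ijw = F₃,₃-covers-pairs i j i≢j
      _ , injective = f-edge i j w ijw
  in i≢j (f-injective (injective _ _ (∈-triple₁ (f i) (f j) (f w)) (∈-triple₂ (f i) (f j) (f w)) eq))

-- Enumerates the three colours other than `a` and `b`: the inner `punchIn` skips the position of
-- `b` among the four colours left without `a`.
avoid : {a b : Fin 5} → a ≢ b → Fin 3 → Fin 5
avoid {a} a≢b t = punchIn a (punchIn (punchOut a≢b) t)

avoid-≢ˡ : {a b : Fin 5} (a≢b : a ≢ b) (t : Fin 3) → avoid a≢b t ≢ a
avoid-≢ˡ a≢b t = Fin.punchInᵢ≢i _ _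

avoid-≢ʳ : {a b : Fin 5} (a≢b : a ≢ b) (t : Fin 3) → avoid a≢b t ≢ b
avoid-≢ʳ {a} a≢b t eq = Fin.punchInᵢ≢i (punchOut a≢b) t
  (Fin.punchIn-injective a _ _ (trans eq (sym (Fin.punchIn-punchOut a≢b))))

avoid-injective : {a b : Fin 5} (a≢b : a ≢ b) → Injective _≡_ _≡_ (avoid a≢b)
avoid-injective {a} a≢b = Fin.punchIn-injective _ _ _ ∘ Fin.punchIn-injective a _ _

-- Each colour class is assumed to have at least `q` vertices, listed by `vertex a`.
module _ {q : ℕ} (c : Fin n → Fin 5) (vertex : Fin 5 → Fin q → Fin n)
  (c-vertex : ∀ a i → c (vertex a i) ≡ a)
  (vertex-injective : ∀ a → Injective _≡_ _≡_ (vertex a)) where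

  -- A covered pair has two different colours, and each of the three other colours supplies `q`
  -- third vertices.
  rainbow-codegrees : PositiveCodegreesAtLeast (rainbow c) (3 * q)
  rainbow-codegrees u v u≢v (e , (_ , injective) , u∈ , v∈) = es , es-injective , es-through
    where
    cu≢cv : c u ≢ c v
    cu≢cv = u≢v ∘ injective u v u∈ v∈
    w : Fin 3 × Fin q → Fin n
    w (t , i) = vertex (avoid cu≢cv t) i
    c-w≢ˡ : ∀ ti → c (w ti) ≢ c u
    c-w≢ˡ (t , i) = avoid-≢ˡ cu≢cv t ∘ trans (sym (c-vertex _ i))
    c-w≢ʳ : ∀ ti → c (w ti) ≢ c v
    c-w≢ʳ (t , i) = avoid-≢ʳ cu≢cv t ∘ trans (sym (c-vertex _ i))
    -- The colour of the vertex recovers `t`; within one colour, `vertex-injective` recovers `i`.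
    w-injective : Injective _≡_ _≡_ w
    w-injective {t , i} {t′ , i′} eq with avoid-injective cu≢cv
      (trans (sym (c-vertex (avoid cu≢cv t) i)) (trans (cong c eq) (c-vertex (avoid cu≢cv t′) i′)))
    ... | refl = cong (t ,_) (vertex-injective _ eq)
    es : Fin (3 * q) → Subset n
    es l = ⁅ w (remQuot q l) , u , v ⁆
    triple-injective : ∀ ti ti′ → ⁅ w ti , u , v ⁆ ≡ ⁅ w ti′ , u , v ⁆ → ti ≡ ti′
    triple-injective ti ti′ eq
      with ∈-triple⁻ (w ti′) u v (subst (w ti ∈_) eq (∈-triple₁ (w ti) u v))
    ... | inj₁ w≡w′        = w-injective w≡w′
    ... | inj₂ (inj₁ w≡u) = contradiction (cong c w≡u) (c-w≢ˡ ti)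
    ... | inj₂ (inj₂ w≡v) = contradiction (cong c w≡v) (c-w≢ʳ ti)
    es-injective : Injective _≡_ _≡_ es
    es-injective {l} {l′} eq = trans (sym (Fin.combine-remQuot {3} q l)) (trans
      (cong (λ ti → combine (proj₁ ti) (proj₂ ti)) (triple-injective (remQuot q l) (remQuot q l′) eq))
      (Fin.combine-remQuot {3} q l′))
    es-through : ∀ l → EdgeThrough (rainbow c) u v (es l)
    es-through l = rainbow-triple c (c-w≢ˡ _) (c-w≢ʳ _) cu≢cv ,
      ∈-triple₂ (w (remQuot q l)) u v , ∈-triple₃ (w (remQuot q l)) u v

  rainbow-nonempty : Fin q → ∃ (IsEdge (rainbow c))
  rainbow-nonempty i = _ , rainbow-triple c
    (distinct (# 0) (# 1) λ ()) (distinct (# 0) (# 2) λ ()) (distinct (# 1) (# 2) λ ())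
    where
    distinct : ∀ a b → a ≢ b → c (vertex a i) ≢ c (vertex b i)
    distinct a b a≢b eq = a≢b (trans (sym (c-vertex a i)) (trans eq (c-vertex b i)))

residue : Fin n → Fin 5
residue x = toℕ x mod 5

-- The number 5i + a, which is below 5⌊n/5⌋ ≤ n.
with-residue : ∀ n → Fin 5 → Fin (n / 5) → Fin n
with-residue n a i = inject≤ (combine i a) (m/n*n≤m n 5)

residue-with-residue : ∀ n a i → residue (with-residue n a i) ≡ a
residue-with-residue n a i = Fin.toℕ-injective (begin
  toℕ (toℕ (with-residue n a i) mod 5) ≡⟨ Fin.toℕ-fromℕ< _ ⟩
  toℕ (with-residue n a i) % 5         ≡⟨ cong (_% 5) (Fin.toℕ-inject≤ (combine i a) _) ⟩
  toℕ (combine i a) % 5                ≡⟨ cong (_% 5) (Fin.toℕ-combine i a) ⟩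
  (5 * toℕ i + toℕ a) % 5              ≡⟨ cong (_% 5) (ℕₚ.+-comm (5 * toℕ i) (toℕ a)) ⟩
  (toℕ a + 5 * toℕ i) % 5              ≡⟨ cong (λ m → (toℕ a + m) % 5) (ℕₚ.*-comm 5 (toℕ i)) ⟩
  (toℕ a + toℕ i * 5) % 5              ≡⟨ [m+kn]%n≡m%n (toℕ a) (toℕ i) 5 ⟩
  toℕ a % 5                            ≡⟨ m<n⇒m%n≡m (Fin.toℕ<n a) ⟩
  toℕ a                                ∎)
  where open ≡-Reasoning

with-residue-injective : ∀ n a → Injective _≡_ _≡_ (with-residue n a)
with-residue-injective n a {i} {j} eq =
  Fin.combine-injectiveˡ i a j a (Fin.inject≤-injective _ _ _ _ eq)

-- An edge is demanded because in an edgeless graph `PositiveCodegreesAtLeast` holds vacuously for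
-- every `k`, which would leave `k` unbounded.
FreeWithCodegrees : 3-Graph p → ℕ → 3-Graph n → Set
FreeWithCodegrees F k H = H IsFreeOf F × ∃ (IsEdge H) × PositiveCodegreesAtLeast H k

Attainable : ℕ → 3-Graph p → ℕ → Set₁
Attainable n F k = ∃[ H ] FreeWithCodegrees {n = n} F k H

zero-or-inhabited : ∀ q → q ≡ 0 ⊎ Fin q
zero-or-inhabited zero    = inj₁ refl
zero-or-inhabited (suc _) = inj₂ zero

-- For n < 5 the bound is 0 and the colouring need not yield an edge, so this case is kept apart.
codegree-lower-bound : ∀ n → n / 5 ≡ 0 ⊎ Attainable n F₃,₃ (3 * (n / 5))
codegree-lower-bound n with zero-or-inhabited (n / 5)
... | inj₁ n/5≡0 = inj₁ n/5≡0
... | inj₂ i     = inj₂ (rainbow residue , rainbow-free residue ,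
  rainbow-nonempty residue (with-residue n) (residue-with-residue n) (with-residue-injective n) i ,
  rainbow-codegrees residue (with-residue n) (residue-with-residue n) (with-residue-injective n))

-- Exhaustive search

Searchable : Set → Set₁
Searchable A = ∀ {P : Pred A 0ℓ} → Decidable P → Dec (∃ P)

searchBool : Searchable Bool
searchBool P? = map′
  (λ { (inj₁ p) → true , p ; (inj₂ p) → false , p })
  (λ { (true , p) → inj₁ p ; (false , p) → inj₂ p })
  (P? true ⊎-dec P? false)

search× : {B : Set} → Searchable A → Searchable B → Searchable (A × B)
search× searchA searchB P? = map′
  (λ (a , b , p) → (a , b) , p) (λ ((a , b) , p) → a , b , p)
  (searchA λ a → searchB λ b → P? (a , b))

searchVec : Searchable A → ∀ k → Searchable (Vec A k)
searchVec searchA zero    P? = map′ ([] ,_) (λ { ([] , p) → p }) (P? [])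
searchVec searchA (suc k) P? = map′
  (λ (a , v , p) → a ∷ v , p) (λ { (a ∷ v , p) → a , v , p })
  (searchA λ a → searchVec searchA k λ v → P? (a ∷ v))

-- Without function extensionality, only extensional predicates on functions can be searched.
searchFun : Searchable A → {P : Pred (Fin k → A) 0ℓ} → (∀ {f g} → f ≗ g → P f → P g) →
  Decidable P → Dec (∃ P)
searchFun {k = k} searchA resp P? = map′
  (λ (v , p) → lookup v , p)
  (λ (f , p) → tabulate f , resp (sym ∘ lookup∘tabulate f) p)
  (searchVec searchA k (P? ∘ lookup))

injective? : (∀ (x y : A) → Dec (x ≡ y)) → (f : Fin k → A) → Dec (Injective _≡_ _≡_ f)
injective? _≟ᴬ_ f = map′ (λ inj {i} {j} → inj i j) (λ inj i j → inj)
  (all? λ i → all? λ j → f i ≟ᴬ f j →-dec i ≟ j)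

injective-resp-≗ : {f g : Fin k → A} → f ≗ g → Injective _≡_ _≡_ f → Injective _≡_ _≡_ g
injective-resp-≗ f≗g inj eq = inj (trans (f≗g _) (trans eq (sym (f≗g _))))

contains? : (H : 3-Graph n) (F : 3-Graph p) → Dec (Contains H F)
contains? H F = searchFun any?
  (λ f≗g (inj , hom) → injective-resp-≗ f≗g inj , λ u v w uvw →
    subst (IsEdge H) (cong₂ _∪_ (cong ｛_｝ (f≗g u)) (cong₂ _∪_ (cong ｛_｝ (f≗g v)) (cong ｛_｝ (f≗g w))))
      (hom u v w uvw))
  (λ f → injective? _≟_ f ×-dec
    (all? λ u → all? λ v → all? λ w → isEdge? F _ →-dec isEdge? H ⁅ f u , f v , f w ⁆))

edgeThrough? : (H : 3-Graph n) (u v : Fin n) → Decidable (EdgeThrough H u v)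
edgeThrough? H u v e = isEdge? H e ×-dec (u ∈? e ×-dec v ∈? e)

codegreeAtLeast? : (H : 3-Graph n) (u v : Fin n) (k : ℕ) → Dec (CodegreeAtLeast H u v k)
codegreeAtLeast? H u v k = searchFun anySubset?
  (λ es≗fs (inj , through) → injective-resp-≗ es≗fs inj , λ i →
    subst (EdgeThrough H u v) (es≗fs i) (through i))
  (λ es → injective? (≡-dec _≟ᵇ_) es ×-dec (all? λ i → edgeThrough? H u v (es i)))

positiveCodegreesAtLeast? : (H : 3-Graph n) (k : ℕ) → Dec (PositiveCodegreesAtLeast H k)
positiveCodegreesAtLeast? H k = all? λ u → all? λ v →
  ¬? (u ≟ v) →-dec (anySubset? (edgeThrough? H u v) →-dec codegreeAtLeast? H u v k)

freeWithCodegrees? : (F : 3-Graph p) (k : ℕ) (H : 3-Graph n) → Dec (FreeWithCodegrees F k H)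
freeWithCodegrees? F k H =
  ¬? (contains? H F) ×-dec (anySubset? (isEdge? H) ×-dec positiveCodegreesAtLeast? H k)

-- The search reaches each 3-graph only up to equivalence of edge predicates, so the property has to
-- be invariant under it.
freeWithCodegrees-resp : {F : 3-Graph p} {H H′ : 3-Graph n} →
  (∀ {e} → IsEdge H e → IsEdge H′ e) → (∀ {e} → IsEdge H′ e → IsEdge H e) →
  FreeWithCodegrees F k H → FreeWithCodegrees F k H′
freeWithCodegrees-resp to from (free , (e , e-edge) , codegrees) =
  (λ (f , inj , hom) → free (f , inj , λ u v w uvw → from (hom u v w uvw))) ,
  (e , to e-edge) ,
  λ u v u≢v (e′ , e′-edge , uv∈) →
    let es , inj , through = codegrees u v u≢v (e′ , from e′-edge , uv∈)
    in es , inj , λ i → to (proj₁ (through i)) , proj₂ (through i)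

-- A family of subsets of Fin n, as a complete binary tree of depth n.
Family : ℕ → Set
Family zero    = Bool
Family (suc n) = Family n × Family n

searchFamily : ∀ n → Searchable (Family n)
searchFamily zero    = searchBool
searchFamily (suc n) = search× (searchFamily n) (searchFamily n)

member : Family n → Subset n → Bool
member t       []            = t
member (t , _) (inside  ∷ e) = member t e
member (_ , t) (outside ∷ e) = member t e

family : (Subset n → Bool) → Family n
family {zero}  f = f []
family {suc n} f = family (f ∘ (inside ∷_)) , family (f ∘ (outside ∷_))

member-family : (f : Subset n → Bool) → member (family f) ≗ f
member-family f []            = refl
member-family f (inside  ∷ e) = member-family (f ∘ (inside ∷_)) e
member-family f (outside ∷ e) = member-family (f ∘ (outside ∷_)) e

-- Members of size other than 3 are discarded, so every family yields a 3-graph.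
fromFamily : Family n → 3-Graph n
fromFamily t = record
  { IsEdge  = λ e → ∣ e ∣ ≡ 3 × T (member t e)
  ; isEdge? = λ e → (∣ e ∣ ℕₚ.≟ 3) ×-dec T? (member t e)
  ; uniform = λ _ → proj₁
  }

attainable? : (n : ℕ) (F : 3-Graph p) → Decidable (Attainable n F)
attainable? n F k = map′
  (λ (t , good) → fromFamily t , good)
  (λ (H , good) → family (λ e → ⌊ isEdge? H e ⌋) ,
   freeWithCodegrees-resp {F = F} {H} {fromFamily _}
    (λ {e} e-edge → uniform H e e-edge , subst T (sym (member-family _ e)) (fromWitness e-edge))
    (λ {e} (_ , e∈) → toWitness (subst T (member-family _ e) e∈))
    good)
  (searchFamily n λ t → freeWithCodegrees? F k (fromFamily t))

-- Existence and bounds of the maximum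

-- Tests `b`, then descends, lowering the bound by one after each failure.
maximum-or-none : {P : Pred ℕ ℓ} → Decidable P → ∀ b →
  (∀ k → P k → k ≤ b) → ∃ (IsMaximum P) ⊎ (∀ k → ¬ P k)
maximum-or-none P? b bound with P? b
... | yes pb = inj₁ (b , pb , bound)
maximum-or-none {P = P} P? zero bound | no ¬p0 = inj₂ λ k pk → ¬p0 (subst P (ℕₚ.n≤0⇒n≡0 (bound k pk)) pk)
maximum-or-none P? (suc b) bound | no ¬pb = maximum-or-none P? b λ k pk →
  s≤s⁻¹ (ℕₚ.≤∧≢⇒< (bound k pk) λ { refl → ¬pb pk })

emptyGraph : ∀ n → 3-Graph n
emptyGraph n = record { IsEdge = λ _ → Empty ; isEdge? = λ _ → no λ () ; uniform = λ _ () }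

emptyGraph-free : (F : 3-Graph p) → (∃[ u ] ∃[ v ] ∃[ w ] IsEdge F ⁅ u , v , w ⁆) →
  emptyGraph n IsFreeOf F
emptyGraph-free _ (u , v , w , uvw) (_ , _ , hom) = hom u v w uvw

-- The graph attaining `m` has minimum positive co-degree exactly `m`, as a larger value would
-- itself be attainable. Edgeless graphs contribute only 0.
maximum⇒co⁺ex : (F : 3-Graph p) {m : ℕ} → IsMaximum (Attainable n F) m → IsCo⁺ex n F m
maximum⇒co⁺ex F ((H , free , edge , codegrees) , maximal) =
  (H , free , inj₂ (edge , codegrees , λ k codegrees′ → maximal k (H , free , edge , codegrees′))) ,
  λ { _ (_ , _ , inj₁ (_ , refl)) → z≤n
    ; k (H′ , free′ , inj₂ (edge′ , codegrees′ , _)) → maximal k (H′ , free′ , edge′ , codegrees′) }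

-- Covers the case where no free graph has an edge, as for n < 3: the empty graph then realises the
-- value 0.
none⇒co⁺ex≡0 : (F : 3-Graph p) → emptyGraph n IsFreeOf F →
  (∀ k → ¬ Attainable n F k) → IsCo⁺ex n F 0
none⇒co⁺ex≡0 {n = n} F empty-free none =
  (emptyGraph n , empty-free , inj₁ ((λ ()) , refl)) ,
  λ { _ (_ , _ , inj₁ (_ , refl)) → z≤n
    ; k (H′ , free′ , inj₂ (edge′ , codegrees′ , _)) → contradiction (H′ , free′ , edge′ , codegrees′) (none k) }

theorem13 : ∀ (n : ℕ) → .{{_ : NonZero n}} →
    ∃[ m ] IsCo⁺ex n F₃,₃ m × 3 * (n / 5) ≤ m × 4 * m ≤ 3 * n
-- The crude search bound `3 * n` follows from k ≤ 4k ≤ 3n.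
theorem13 n = [ attained , vacuous ]′ (maximum-or-none (attainable? n F₃,₃) (3 * n)
  λ k good → ℕₚ.≤-trans (ℕₚ.m≤n*m k 4) (upper good))
  where
  Conclusion : Set₁
  Conclusion = ∃[ m ] IsCo⁺ex n F₃,₃ m × 3 * (n / 5) ≤ m × 4 * m ≤ 3 * n
  upper : ∀ {k} → Attainable n F₃,₃ k → 4 * k ≤ 3 * n
  upper (H , free , edge , codegrees) = codegree-upper-bound H free edge codegrees
  -- The premise is discharged by maximality when a maximum exists, and by contradiction when
  -- nothing is attainable.
  lower : ∀ {m} → (Attainable n F₃,₃ (3 * (n / 5)) → 3 * (n / 5) ≤ m) → 3 * (n / 5) ≤ m
  lower {m} = [ (λ n/5≡0 _ → subst (λ q → 3 * q ≤ m) (sym n/5≡0) z≤n) , (λ good bound → bound good) ]′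
    (codegree-lower-bound n)
  attained : ∃ (IsMaximum (Attainable n F₃,₃)) → Conclusion
  attained (m , max@(good , maximal)) = m , maximum⇒co⁺ex F₃,₃ max , lower (maximal _) , upper good
  vacuous : (∀ k → ¬ Attainable n F₃,₃ k) → Conclusion
  vacuous none = 0 ,
    none⇒co⁺ex≡0 F₃,₃ (emptyGraph-free F₃,₃ (# 0 , # 1 , # 2 , here refl)) none ,
    lower (λ good → contradiction good (none _)) ,
    z≤n
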